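{- For every odd $m\ge 3$, the Sperner systems $\mathcal{S}^m_1$ and $\mathcal{S}^m_2$ are nonisomorphic.
   Context: A set system over a finite set $A$ is a set of subsets of $A$, called blocks; it is a Sperner system if no block is included in another. Set systems $\mathcal A$ over $A$ and $\mathcal B$ over $B$ are isomorphic if there is a bijection $\sigma\colon A\to B$ with $\{\sigma(S):S\in\mathcal A\}=\mathcal B$. Let $[m]=\{1,\dots,m\}$. For each $n\in[m]$ let $n'$ be a new element (a primed copy of $n$), and $S'=\{n':n\in S\}$ for $S\subseteq[m]$. Let $E_m=[m]\cup[m]'$ ($2m$ elements). Addition in $[m]$ is modulo $m$ with result in $[m]$; $X+q=\{x+q:x\in X\}$. Let $\rho$ be the permutation of $E_m$ with $\rho(j)=j+1$, $\rho(j')=(j+1)'$; for a set system $\mathcal A$ over $E_m$ let $\langle\mathcal A\rangle=\bigcup_{i\in[m]}\rho^i(\mathcal A)$. For $J\subseteq[m]$ let $F^m_J=J\cup([m]\setminus J)'$; $\mathcal F^m_1=\{F^m_J:|J|\text{ odd}\}$, $\mathcal F^m_2=\{F^m_J:|J|\text{ even}\}$. For disjoint $X,Y\subseteq[m]$ let $[X|Y]$ be the set of all $J\subseteq E_m$ such that $|\{x,x'\}\cap J|=2$ for all $x\in X$, $|\{y,y'\}\cap J|=0$ for all $y\in Y$, and $|\{z,z'\}\cap J|=1$ for all $z\in[m]\setminus(X\cup Y)$. Let $\langle X|Y\rangle=\langle[X|Y]\rangle=\bigcup_{q\in[m]}[X+q|Y+q]$. Let $\Omega=\{\langle X|Y\rangle: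 X,Y\subseteq[m],\ |X|=|Y|,\ X\cap Y=\emptyset\}\setminus\{\langle\emptyset|\emptyset\rangle\}$. Signature: for disjoint $X,Y\subseteq[m]$, $(X,Y)\ne(\emptyset,\emptyset)$, let $d_1\dots d_m$ be the string with $d_i=x$ if $i\in X$, $d_i=y$ if $i\in Y$, $d_i=z$ otherwise. Let $d'_1\dots d'_m$ be the unique string (indices cyclic modulo $m$) such that $d'_i=d_i$ if $d_i\in\{x,y\}$; and if $d_i=z$ then $d'_i\in\{\alpha,\beta\}$, $d'_i\ne d'_{i-1}$, with $d'_i=\beta$ if $d_{i-1}=x$ and $d'_i=\alpha$ if $d_{i-1}=y$. Then $\mathrm{sgn}(X,Y)$ is the set of those $e\in\{\alpha,\beta\}$ that occur an odd number of times in $d'_1\dots d'_m$; the singletons $\{\alpha\},\{\beta\}$ are written $\alpha,\beta$. It is invariant under replacing $(X,Y)$ by $(X+q,Y+q)$, and $\mathrm{sgn}\langle X|Y\rangle:=\mathrm{sgn}(X,Y)$ is well defined. For odd $m\ge3$ let $C_m=\{1,3,\dots,m-2\}$, $A_m=\{m\}\cup(C_m+1)\cup(C_m+1)'$, $B_m=\{m\}\cup C_m\cup C_m'$, and $$\mathcal H^m=\langle\{A_m,B_m\}\rangle\cup\bigcup\{Q\in\Omega\setminus\{\langle C_m|C_m+1\rangle,\langle C_m+1|C_m\rangle\}:\mathrm{sgn}\,Q=\beta\}.$$ For $i\in\{1,2\}$ let $\mathcal S^m_i=\mathcal H^m\cup\mathcal F^m_i$, a Sperner system over $E_m$. -}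

module Defs where

open import Data.Bool.Base using (Bool; true; false; if_then_else_)
open import Data.Fin.Base using (Fin; toℕ; _↑ˡ_; _↑ʳ_; join; splitAt)
open import Data.Fin.Permutation using (Permutation; _⟨$⟩ʳ_)
open import Data.Fin.Properties using (any?; nonZeroIndex) renaming (_≟_ to _≟ᶠ_)
open import Data.Fin.Subset using (Subset; ⁅_⁆; ∣_∣; ∁; ⊥; _∈_; _∉_; _∩_; _∪_)
open import Data.Fin.Subset.Properties using (_∈?_)
open import Data.Nat.Base using (ℕ; suc; _+_; _∸_; parity)
open import Data.Nat.DivMod using (_mod_)
open import Data.Nat.GeneralisedArithmetic using (iterate)
open import Data.Nat.Properties using (_≤?_) renaming (_≟_ to _≟ⁿ_)
open import Data.Parity.Base using (0ℙ; 1ℙ)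
open import Data.Parity.Properties using () renaming (_≟_ to _≟ᵖ_)
open import Data.Product.Base using (∃; ∃₂; _×_)
open import Data.Sum.Base as Sum using (_⊎_)
open import Data.Vec.Base using (_++_; tabulate; lookup)
open import Level using (0ℓ)
open import Relation.Binary.PropositionalEquality using (_≡_; _≢_)
open import Relation.Nullary using (¬_; does; _×-dec_)
open import Relation.Unary using (Pred; Decidable; _≐_; ｛_｝; ⋃) renaming (_∪_ to _∪ᵖ_)

Odd Even : ℕ → Set
Odd  n = parity n ≡ 1ℙ
Even n = parity n ≡ 0ℙ

------------------------------------------------------------------------
-- Set systems over the finite set Fin n.  Subset n is a type of Boolean
-- vectors, so propositional equality of blocks is extensional equality.

SetSystem : ℕ → Set₁
SetSystem n = Pred (Subset n) 0ℓ

⟦_⟧ : ∀ {n} {P : Pred (Fin n) 0ℓ} → Decidable P → Subset n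
⟦ P? ⟧ = tabulate (λ i → does (P? i))

image : ∀ {k n} → (Fin k → Fin n) → Subset k → Subset n
image f S = ⟦ (λ b → any? (λ a → (a ∈? S) ×-dec (f a ≟ᶠ b))) ⟧

imageSystem : ∀ {k n} → (Fin k → Fin n) → SetSystem k → SetSystem n
imageSystem f 𝒜 T = ∃ λ S → 𝒜 S × T ≡ image f S

Isomorphic : ∀ {k n} → SetSystem k → SetSystem n → Set
Isomorphic {k} {n} 𝒜 ℬ =
  ∃ λ (σ : Permutation k n) → imageSystem (σ ⟨$⟩ʳ_) 𝒜 ≐ ℬ

------------------------------------------------------------------------
-- Fin m stands for [m] = {1, …, m}; the index i stands for the number
-- label i.

label : ∀ {m} → Fin m → ℕ
label i = suc (toℕ i)

-- j ↦ j + 1 in [m], with m + 1 = 1.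
next : ∀ {m} → Fin m → Fin m
next {m} i = (suc (toℕ i) mod m) {{nonZeroIndex i}}

-- E m = [m] ∪ [m]′.  For S, T ⊆ [m], the subset S ∪ T′ of E m is the
-- concatenation S ++ T.
E : ℕ → ℕ
E m = m + m

unprimed primed : ∀ {m} → Fin m → Fin (E m)
unprimed {m} j = j ↑ˡ m
primed   {m} j = m ↑ʳ j

ρ : (m : ℕ) → Fin (E m) → Fin (E m)
ρ m e = join m m (Sum.map next next (splitAt m e))

-- ⟨ 𝒜 ⟩, the union of the systems ρⁱ(𝒜) over i ∈ [m].
orbit : (m : ℕ) → SetSystem (E m) → SetSystem (E m)
orbit m 𝒜 = ⋃ (Fin m) (λ i → imageSystem (λ e → iterate (ρ m) e (label i)) 𝒜)

F : ∀ {m} → Subset m → Subset (E m)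
F J = J ++ ∁ J

𝓕₁ 𝓕₂ : (m : ℕ) → SetSystem (E m)
𝓕₁ m S = ∃ λ (J : Subset m) → Odd  ∣ J ∣ × S ≡ F J
𝓕₂ m S = ∃ λ (J : Subset m) → Even ∣ J ∣ × S ≡ F J

[_∥_] : ∀ {m} → Subset m → Subset m → SetSystem (E m)
[_∥_] {m} X Y J =
    (∀ x → x ∈ X → meet x ≡ 2)
  × (∀ y → y ∈ Y → meet y ≡ 0)
  × (∀ z → z ∉ X ∪ Y → meet z ≡ 1)
  where
  meet : Fin m → ℕ
  meet i = ∣ (⁅ unprimed i ⁆ ∪ ⁅ primed i ⁆) ∩ J ∣

⟨_∥_⟩ : ∀ {m} → Subset m → Subset m → SetSystem (E m)
⟨_∥_⟩ {m} X Y = orbit m [ X ∥ Y ]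

-- The members of Ω are the systems ⟨ X ∥ Y ⟩ with InΩ X Y.
InΩ : ∀ {m} → Subset m → Subset m → Set
InΩ {m} X Y =
  ∣ X ∣ ≡ ∣ Y ∣ × X ∩ Y ≡ ⊥ × ¬ (⟨ X ∥ Y ⟩ ≐ ⟨_∥_⟩ {m} ⊥ ⊥)

------------------------------------------------------------------------

data Letter : Set where
  x y z α β : Letter

_==_ : Letter → Letter → Bool
x == x = true
y == y = true
z == z = true
α == α = true
β == β = true
_ == _ = false

occurrences : ∀ {m} → Letter → (Fin m → Letter) → ℕ
occurrences e w = ∣ tabulate (λ i → w i == e) ∣

word : ∀ {m} → Subset m → Subset m → Fin m → Letter
word X Y i = if lookup X i then x else if lookup Y i then y else z

-- The rules for d′ᵢ that refer to the cyclically preceding position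
-- i - 1 are stated for the consecutive positions i and next i.
record Completes {m : ℕ} (d d′ : Fin m → Letter) : Set where
  field
    keep      : ∀ i → d i ≡ x ⊎ d i ≡ y → d′ i ≡ d i
    greek     : ∀ i → d i ≡ z → d′ i ≡ α ⊎ d′ i ≡ β
    alternate : ∀ i → d (next i) ≡ z → d′ (next i) ≢ d′ i
    after-x   : ∀ i → d (next i) ≡ z → d i ≡ x → d′ (next i) ≡ β
    after-y   : ∀ i → d (next i) ≡ z → d i ≡ y → d′ (next i) ≡ α

-- For disjoint X, Y that are not both empty there is exactly one d′
-- completing word X Y.
sgn : ∀ {m} → Subset m → Subset m → Pred Letter 0ℓ
sgn {m} X Y e = (e ≡ α ⊎ e ≡ β) ×
  ∃ λ (d′ : Fin m → Letter) → Completes (word X Y) d′ × Odd (occurrences e d′)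

------------------------------------------------------------------------

C C+1 : (m : ℕ) → Subset m
C m   = ⟦ (λ i → (parity (label i) ≟ᵖ 1ℙ) ×-dec (label i ≤? m ∸ 2)) ⟧
C+1 m = image next (C m)

-- {m} as a subset of [m].
last : (m : ℕ) → Subset m
last m = ⟦ (λ i → label i ≟ⁿ m) ⟧

A B : (m : ℕ) → Subset (E m)
A m = (last m ∪ C+1 m) ++ C+1 m
B m = (last m ∪ C m) ++ C m

-- sgn Q is read off from a representative (X , Y) of Q = ⟨ X ∥ Y ⟩; it
-- does not depend on the choice.
𝓗 : (m : ℕ) → SetSystem (E m)
𝓗 m = orbit m (｛ A m ｝ ∪ᵖ ｛ B m ｝) ∪ᵖ λ J →
  ∃₂ λ (X Y : Subset m) →
      InΩ X Y
    × ¬ (⟨ X ∥ Y ⟩ ≐ ⟨ C m ∥ C+1 m ⟩)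
    × ¬ (⟨ X ∥ Y ⟩ ≐ ⟨ C+1 m ∥ C m ⟩)
    × sgn X Y ≐ ｛ β ｝
    × ⟨ X ∥ Y ⟩ J

𝒮₁ 𝒮₂ : (m : ℕ) → SetSystem (E m)
𝒮₁ m = 𝓗 m ∪ᵖ 𝓕₁ m
𝒮₂ m = 𝓗 m ∪ᵖ 𝓕₂ m

{-# OPTIONS --safe #-}

module Submission where

-- In both systems more blocks pass through an element j than through its
-- copy j′.  By rotation it suffices to compare m with m′, where exchanging
-- the two is an injection that keeps every ⟨ X ∥ Y ⟩, and A m is not hit:
-- exchanging m and m′ in it gives a block of the excluded ⟨ C+1 m ∥ C m ⟩.
-- So an isomorphism from 𝒮₁ m to 𝒮₂ m maps [m] to itself.  For odd m the
-- set [m] is a block of 𝒮₁ m, whereas every block of 𝒮₂ m meets [m]′.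

open import Defs
open import Data.Bool.Base using (Bool; true; false; not; if_then_else_; _∨_)
open import Data.Bool.Properties as Bool using (∨-zeroʳ; not-injective; not-involutive)
open import Data.Fin.Base using (Fin; zero; suc; toℕ; fromℕ; inject₁; funToFin; finToFun; splitAt)
open import Data.Fin.Permutation as Perm using (Permutation; permutation; _⟨$⟩ʳ_; _⟨$⟩ˡ_; inverseˡ; inverseʳ)
open import Data.Fin.Properties using (any?; all?; pigeonhole; 2↔Bool; finToFun-funToFin; splitAt-↑ˡ; splitAt-↑ʳ; join-splitAt; toℕ-injective; toℕ-fromℕ; toℕ-fromℕ<; toℕ-inject₁; toℕ<n) renaming (_≟_ to _≟ᶠ_)
open import Data.Fin.Subset using (Subset; ⁅_⁆; ∣_∣; ∁; ⊥; ⊤; _∈_; _∉_; _∩_; _∪_)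
open import Data.Fin.Subset.Properties using (_∈?_; ∪-identityˡ; ∪-identityʳ; ∩-zeroˡ; ∣⊤∣≡n; ∣⊥∣≡0; Empty-unique; x∈p∪q⁺; x∈p∪q⁻)
open import Data.Nat.Base using (ℕ; zero; suc; _+_; _*_; _^_; _∸_; _%_; _/_; _≤_; _<_; z≤n; s≤s; parity)
open import Data.Nat.DivMod using (_mod_; m≡m%n+[m/n]*n; m%n<n; %-distribˡ-+; m%n%n≡m%n; m<n⇒m%n≡m; [m+n]%n≡m%n)
open import Data.Nat.GeneralisedArithmetic using (iterate)
import Data.Nat.Properties as ℕ
open import Algebra.Properties.CommutativeMonoid.Sum ℕ.+-0-commutativeMonoid using (sum; sum-permute; sum-cong-≗)
open import Data.Parity.Base using (Parity; 0ℙ; 1ℙ; _⁻¹)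
open import Data.Parity.Properties using (⁻¹-involutive; suc-homo-⁻¹) renaming (_≟_ to _≟ᵖ_)
open import Data.Product.Base using (∃; ∃₂; _×_; _,_; proj₁; proj₂)
open import Data.Sum.Base as Sum using (_⊎_; inj₁; inj₂)
open import Data.Vec.Base using (Vec; []; _∷_; _++_; tabulate; lookup; updateAt)
open import Data.Vec.Properties using (lookup∘tabulate; tabulate∘lookup; tabulate-cong; lookup-++ˡ; lookup-++ʳ; lookup⇒[]=; []=⇒lookup; lookup-map; lookup-zipWith; lookup-replicate; lookup∘updateAt; lookup∘updateAt′)
open import Function.Base using (_∘_; id)
open import Function.Bundles using (Inverse)
open import Level using (0ℓ)
open import Relation.Binary.PropositionalEquality
open import Relation.Nullary using (¬_; Dec; yes; no; does; contradiction; _×-dec_)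
open import Relation.Nullary.Decidable using (dec-true; dec-false)
open import Relation.Unary using (Pred; Decidable; _⊆_; _≐_; ｛_｝) renaming (_∪_ to _∪ᵖ_)

-- Membership in `𝓗 m` involves inequality of set systems and completed words, and is nowhere
-- decided, so blocks are compared by injections instead of being counted: `P ≼ Q` plays the part of
-- |P| ≤ |Q|, and `P ≺ Q` of |P| < |Q|. The asymmetry between m and m′ comes only from the rotations
-- of `A m` and `B m`. Each of these blocks contains j whenever it contains j′, so exchanging m and
-- m′ is never called for on a block that has m′ but not m. On the blocks from Ω the exchange is
-- harmless, because `[ X ∥ Y ]` sees only how many of j, j′ a block contains. On the sets `F J` it
-- changes the parity of J, and this is the one place where the plain exchange must be repaired.

lookup-ext : ∀ {n} {A : Set} {S T : Vec A n} → (∀ e → lookup S e ≡ lookup T e) → S ≡ T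
lookup-ext {S = S} {T} h =
  trans (sym (tabulate∘lookup S)) (trans (tabulate-cong h) (tabulate∘lookup T))

false≢true : false ≢ true
false≢true ()

-- Images of blocks under permutations

lookup-image : ∀ {k n} (π : Permutation k n) S b →
  lookup (image (π ⟨$⟩ʳ_) S) b ≡ lookup S (π ⟨$⟩ˡ b)
lookup-image π S b = trans (lookup∘tabulate _ b) (by (lookup S (π ⟨$⟩ˡ b)) refl)
  where
  hit? : Dec (∃ λ a → a ∈ S × π ⟨$⟩ʳ a ≡ b)
  hit? = any? λ a → (a ∈? S) ×-dec (π ⟨$⟩ʳ a ≟ᶠ b)
  by : ∀ c → lookup S (π ⟨$⟩ˡ b) ≡ c → does hit? ≡ c
  by true  eq = dec-true hit? (π ⟨$⟩ˡ b , lookup⇒[]= _ S eq , inverseʳ π)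
  by false eq = dec-false hit? λ where
    (a , a∈S , refl) →
      false≢true (trans (sym eq) (trans (cong (lookup S) (inverseˡ π)) ([]=⇒lookup a∈S)))

lookup-image-to : ∀ {k n} (π : Permutation k n) S a →
  lookup (image (π ⟨$⟩ʳ_) S) (π ⟨$⟩ʳ a) ≡ lookup S a
lookup-image-to π S a = trans (lookup-image π S _) (cong (lookup S) (inverseˡ π))

image-injective : ∀ {k n} (π : Permutation k n) {S T} →
  image (π ⟨$⟩ʳ_) S ≡ image (π ⟨$⟩ʳ_) T → S ≡ T
image-injective π {S} {T} eq = lookup-ext λ e →
  trans (sym (lookup-image-to π S e))
    (trans (cong (λ U → lookup U (π ⟨$⟩ʳ e)) eq) (lookup-image-to π T e))

-- Injections between families of blocks

infix 4 _≼_ _≺_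

record _≼_ {k n} (P : SetSystem k) (Q : SetSystem n) : Set where
  field
    to        : Subset k → Subset n
    maps      : ∀ {S} → P S → Q (to S)
    injective : ∀ {S T} → P S → P T → to S ≡ to T → S ≡ T

record _≺_ {k n} (P : SetSystem k) (Q : SetSystem n) : Set where
  field
    embedding : P ≼ Q
    missed    : Subset n
    missed∈   : Q missed
    misses    : ∀ {S} → P S → _≼_.to embedding S ≢ missed

≼-trans : ∀ {k l n} {P : SetSystem k} {Q : SetSystem l} {R : SetSystem n} →
  P ≼ Q → Q ≼ R → P ≼ R
≼-trans f g = record
  { to        = G.to ∘ F.to
  ; maps      = G.maps ∘ F.maps
  ; injective = λ p q → F.injective p q ∘ G.injective (F.maps p) (F.maps q)
  }
  where
  module F = _≼_ f
  module G = _≼_ g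

≼-≺-trans : ∀ {k l n} {P : SetSystem k} {Q : SetSystem l} {R : SetSystem n} →
  P ≼ Q → Q ≺ R → P ≺ R
≼-≺-trans f g = record
  { embedding = ≼-trans f G.embedding
  ; missed    = G.missed
  ; missed∈   = G.missed∈
  ; misses    = G.misses ∘ F.maps
  }
  where
  module F = _≼_ f
  module G = _≺_ g

encode : ∀ {n} → Subset n → Fin (2 ^ n)
encode S = funToFin (Inverse.from 2↔Bool ∘ lookup S)

encode-injective : ∀ {n} {S T : Subset n} → encode S ≡ encode T → S ≡ T
encode-injective {S = S} {T} eq = lookup-ext λ e →
  trans (sym (decode S e)) (trans (cong (λ c → Inverse.to 2↔Bool (finToFun c e)) eq) (decode T e))
  where
  decode : ∀ U e → Inverse.to 2↔Bool (finToFun (encode U) e) ≡ lookup U e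
  decode U e = trans (cong (Inverse.to 2↔Bool) (finToFun-funToFin (Inverse.from 2↔Bool ∘ lookup U) e))
                 (Inverse.inverseˡ 2↔Bool refl)

-- The orbit of the missed block under the embedding would be infinite.
≺-irrefl : ∀ {n} {P : SetSystem n} → ¬ P ≺ P
≺-irrefl {n} {P} f = ¬repetition (pigeonhole (ℕ.n<1+n (2 ^ n)) (encode ∘ orb ∘ toℕ))
  where
  open _≺_ f
  open _≼_ embedding

  orb : ℕ → Subset n
  orb zero    = missed
  orb (suc i) = to (orb i)

  orb∈ : ∀ i → P (orb i)
  orb∈ zero    = missed∈
  orb∈ (suc i) = maps (orb∈ i)

  orb-distinct : ∀ {i j} → i < j → orb i ≢ orb j
  -- A coincidence with the start would put the missed block into the image; any other loses one
  -- application of `to` on both sides.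
  orb-distinct {zero}  {suc j} _   eq = misses (orb∈ j) (sym eq)
  orb-distinct {suc i} {suc j} (s≤s i<j) eq =
    orb-distinct i<j (injective (orb∈ i) (orb∈ j) eq)

  ¬repetition : ¬ (∃₂ λ i j → toℕ i < toℕ j × encode (orb (toℕ i)) ≡ encode (orb (toℕ j)))
  ¬repetition (i , j , i<j , eq) = orb-distinct i<j (encode-injective eq)

-- Powers of a periodic map, and sizes of images

module _ {A : Set} (f : A → A) where

  iterate-+ : ∀ e a b → iterate f e (a + b) ≡ iterate f (iterate f e a) b
  iterate-+ e zero    b = refl
  iterate-+ e (suc a) b = iterate-+ (f e) a b

  iterate-period : ∀ {p} → (∀ e → iterate f e p ≡ e) → ∀ c e → iterate f e (c * p) ≡ e
  iterate-period     period zero    e = refl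
  iterate-period {p} period (suc c) e =
    trans (iterate-+ e p (c * p)) (trans (iterate-period period c _) (period e))

-- With period n + 1, the inverse of the j-th power is the (j * n)-th, because j * n + j is a
-- multiple of the period. This avoids negative exponents.
powerᵖ : ∀ {k n} (f : Fin k → Fin k) → (∀ e → iterate f e (suc n) ≡ e) → ℕ → Permutation k k
powerᵖ {k} {n} f period j = permutation (λ e → iterate f e j) (λ e → iterate f e (j * n)) left right
  where
  left : ∀ e → iterate f (iterate f e (j * n)) j ≡ e
  left e = trans (sym (iterate-+ f e (j * n) j))
    (trans (cong (iterate f e) (trans (ℕ.+-comm (j * n) j) (sym (ℕ.*-suc j n)))) (iterate-period f period j e))
  right : ∀ e → iterate f (iterate f e j) (j * n) ≡ e
  right e = trans (sym (iterate-+ f e j (j * n)))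
    (trans (cong (iterate f e) (sym (ℕ.*-suc j n))) (iterate-period f period j e))

bit : Bool → ℕ
bit true  = 1
bit false = 0

∣∣-sum : ∀ {n} (S : Subset n) → ∣ S ∣ ≡ sum (bit ∘ lookup S)
∣∣-sum []          = refl
∣∣-sum (true  ∷ S) = cong suc (∣∣-sum S)
∣∣-sum (false ∷ S) = ∣∣-sum S

∣image∣ : ∀ {k n} (π : Permutation k n) S → ∣ image (π ⟨$⟩ʳ_) S ∣ ≡ ∣ S ∣
∣image∣ π S = begin
  ∣ image (π ⟨$⟩ʳ_) S ∣                             ≡⟨ ∣∣-sum (image (π ⟨$⟩ʳ_) S) ⟩
  sum (bit ∘ lookup (image (π ⟨$⟩ʳ_) S))            ≡⟨ sum-permute _ π ⟩
  sum (λ e → bit (lookup (image (π ⟨$⟩ʳ_) S) (π ⟨$⟩ʳ e))) ≡⟨ sum-cong-≗ (cong bit ∘ lookup-image-to π S) ⟩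
  sum (bit ∘ lookup S)                              ≡⟨ ∣∣-sum S ⟨
  ∣ S ∣                                             ∎
  where open ≡-Reasoning

-- Rotations

module _ {m : ℕ} where

  data Half : Fin (E m) → Set where
    isUnprimed : ∀ (j : Fin m) → Half (unprimed j)
    isPrimed   : ∀ (j : Fin m) → Half (primed j)

  half : ∀ e → Half e
  half e with splitAt m e | join-splitAt m m e
  ... | inj₁ j | refl = isUnprimed j
  ... | inj₂ j | refl = isPrimed j

  E-ext : {S T : Subset (E m)} →
    (∀ (j : Fin m) → lookup S (unprimed j) ≡ lookup T (unprimed j)) →
    (∀ (j : Fin m) → lookup S (primed j) ≡ lookup T (primed j)) → S ≡ T
  E-ext {S} {T} h h′ = lookup-ext λ e → at (half e)
    where
    at : ∀ {e} → Half e → lookup S e ≡ lookup T e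
    at (isUnprimed j) = h j
    at (isPrimed j)   = h′ j

  iterate-ρ-unprimed : ∀ k (j : Fin m) → iterate (ρ m) (unprimed j) k ≡ unprimed (iterate next j k)
  iterate-ρ-unprimed zero    j = refl
  iterate-ρ-unprimed (suc k) j rewrite splitAt-↑ˡ m j m = iterate-ρ-unprimed k (next j)

  iterate-ρ-primed : ∀ k (j : Fin m) → iterate (ρ m) (primed j) k ≡ primed (iterate next j k)
  iterate-ρ-primed zero    j = refl
  iterate-ρ-primed (suc k) j rewrite splitAt-↑ʳ m m j = iterate-ρ-primed k (next j)

module Rotation (n : ℕ) where

  m : ℕ
  m = suc n

  toℕ-next : ∀ (i : Fin m) → toℕ (next i) ≡ suc (toℕ i) % m
  toℕ-next i = toℕ-fromℕ< (m%n<n (suc (toℕ i)) m)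

  toℕ-iterate-next : ∀ k (i : Fin m) → toℕ (iterate next i k) ≡ (toℕ i + k) % m
  toℕ-iterate-next zero    i = begin
    toℕ i           ≡⟨ m<n⇒m%n≡m (toℕ<n i) ⟨
    toℕ i % m       ≡⟨ cong (_% m) (ℕ.+-comm 0 (toℕ i)) ⟩
    (toℕ i + 0) % m ∎
    where open ≡-Reasoning
  toℕ-iterate-next (suc k) i = begin
    toℕ (iterate next (next i) k)         ≡⟨ toℕ-iterate-next k (next i) ⟩
    (toℕ (next i) + k) % m                ≡⟨ cong (λ t → (t + k) % m) (toℕ-next i) ⟩
    (suc (toℕ i) % m + k) % m             ≡⟨ %-distribˡ-+ (suc (toℕ i) % m) k m ⟩
    (suc (toℕ i) % m % m + k % m) % m     ≡⟨ cong (λ t → (t + k % m) % m) (m%n%n≡m%n (suc (toℕ i)) m) ⟩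
    (suc (toℕ i) % m + k % m) % m         ≡⟨ %-distribˡ-+ (suc (toℕ i)) k m ⟨
    (suc (toℕ i) + k) % m                 ≡⟨ cong (_% m) (ℕ.+-suc (toℕ i) k) ⟨
    (toℕ i + suc k) % m                   ∎
    where open ≡-Reasoning

  next-period : ∀ (i : Fin m) → iterate next i m ≡ i
  next-period i = toℕ-injective
    (trans (toℕ-iterate-next m i) (trans ([m+n]%n≡m%n (toℕ i) m) (m<n⇒m%n≡m (toℕ<n i))))

  ρ-period : ∀ e → iterate (ρ m) e m ≡ e
  ρ-period e = at (half e)
    where
    at : ∀ {e} → Half {m} e → iterate (ρ m) e m ≡ e
    at (isUnprimed j) = trans (iterate-ρ-unprimed m j) (cong unprimed (next-period j))
    at (isPrimed j)   = trans (iterate-ρ-primed m j) (cong primed (next-period j))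

  nextᵖ : ℕ → Permutation m m
  nextᵖ = powerᵖ {n = n} next next-period

  ρᵖ : ℕ → Permutation (E m) (E m)
  ρᵖ = powerᵖ {n = n} (ρ m) ρ-period

  rot : ℕ → Subset (E m) → Subset (E m)
  rot k = image (ρᵖ k ⟨$⟩ʳ_)

  next-transitive : ∀ (i j : Fin m) → ∃ λ k → iterate next i k ≡ j
  next-transitive i j = k , toℕ-injective (begin
    toℕ (iterate next i k)                         ≡⟨ toℕ-iterate-next k i ⟩
    (toℕ i + k) % m                                ≡⟨ cong (_% m) (ℕ.+-assoc (toℕ i) (m ∸ toℕ i) (toℕ j)) ⟨
    (toℕ i + (m ∸ toℕ i) + toℕ j) % m ≡⟨ cong (λ t → (t + toℕ j) % m) (ℕ.m+[n∸m]≡n (ℕ.<⇒≤ (toℕ<n i))) ⟩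
    (m + toℕ j) % m                                ≡⟨ cong (_% m) (ℕ.+-comm m (toℕ j)) ⟩
    (toℕ j + m) % m                                ≡⟨ [m+n]%n≡m%n (toℕ j) m ⟩
    toℕ j % m                                      ≡⟨ m<n⇒m%n≡m (toℕ<n j) ⟩
    toℕ j                                          ∎)
    where
    open ≡-Reasoning
    k : ℕ
    -- The shift j - i, increased by m to stay in the natural numbers.
    k = (m ∸ toℕ i) + toℕ j

  rot-+ : ∀ a b S → rot b (rot a S) ≡ rot (a + b) S
  rot-+ a b S = lookup-ext λ e → begin
    lookup (rot b (rot a S)) e                              ≡⟨ lookup-image (ρᵖ b) (rot a S) e ⟩
    lookup (rot a S) (iterate (ρ m) e (b * n))              ≡⟨ lookup-image (ρᵖ a) S _ ⟩
    lookup S (iterate (ρ m) (iterate (ρ m) e (b * n)) (a * n)) ≡⟨ cong (lookup S) (iterate-+ (ρ m) e (b * n) (a * n)) ⟨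
    lookup S (iterate (ρ m) e (b * n + a * n))              ≡⟨ cong (λ t → lookup S (iterate (ρ m) e t))
                                                                 (trans (ℕ.+-comm (b * n) (a * n)) (sym (ℕ.*-distribʳ-+ n a b))) ⟩
    lookup S (iterate (ρ m) e ((a + b) * n))                ≡⟨ lookup-image (ρᵖ (a + b)) S e ⟨
    lookup (rot (a + b) S) e                                ∎
    where open ≡-Reasoning

  rot-period : ∀ c S → rot (c * m) S ≡ S
  rot-period c S = lookup-ext λ e →
    trans (cong (lookup (rot (c * m) S)) (sym (iterate-period (ρ m) ρ-period c e)))
      (lookup-image-to (ρᵖ (c * m)) S e)

  rot-inverse : ∀ k S → rot (k * n) (rot k S) ≡ S
  rot-inverse k S = trans (rot-+ k (k * n) S)
    (trans (cong (λ t → rot t S) (sym (ℕ.*-suc k n))) (rot-period k S))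

  rot∈orbit : ∀ {𝒜 : SetSystem (E m)} k {S} → 𝒜 S → orbit m 𝒜 (rot k S)
  rot∈orbit k {S} S∈𝒜 = q , S , S∈𝒜 , (begin
    rot k S                                        ≡⟨ rot-period 1 (rot k S) ⟨
    rot (1 * m) (rot k S)                          ≡⟨ rot-+ k (1 * m) S ⟩
    rot (k + 1 * m) S                              ≡⟨ cong (λ t → rot t S) exponent ⟩
    rot (label q + (k + n) / m * m) S              ≡⟨ rot-+ (label q) ((k + n) / m * m) S ⟨
    rot ((k + n) / m * m) (rot (label q) S)        ≡⟨ rot-period ((k + n) / m) _ ⟩
    rot (label q) S                                ∎)
    where
    open ≡-Reasoning
    q : Fin m
    -- An orbit uses the exponents 1, ..., m, so `label q` must be congruent to k modulo m. Adding n
    -- = m - 1 before reducing makes up for the 1 that `label` adds.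
    q = (k + n) mod m
    exponent : k + 1 * m ≡ label q + (k + n) / m * m
    exponent = begin
      k + 1 * m                              ≡⟨ cong (k +_) (ℕ.+-comm m 0) ⟩
      k + suc n                              ≡⟨ ℕ.+-suc k n ⟩
      suc (k + n)                            ≡⟨ cong suc (m≡m%n+[m/n]*n (k + n) m) ⟩
      suc ((k + n) % m) + (k + n) / m * m    ≡⟨ cong (λ t → suc t + (k + n) / m * m) (toℕ-fromℕ< (m%n<n (k + n) m)) ⟨
      label q + (k + n) / m * m              ∎

  orbit-rot : ∀ {𝒜 : SetSystem (E m)} k {T} → orbit m 𝒜 T → orbit m 𝒜 (rot k T)
  orbit-rot {𝒜} k (q , S , S∈𝒜 , refl) =
    subst (orbit m 𝒜) (sym (rot-+ (label q) k S)) (rot∈orbit (label q + k) S∈𝒜)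

  ⊆orbit : ∀ {𝒜 : SetSystem (E m)} → 𝒜 ⊆ orbit m 𝒜
  ⊆orbit {𝒜} {S} S∈𝒜 = subst (orbit m 𝒜) (rot-period 0 S) (rot∈orbit 0 S∈𝒜)

  lookup-rot-unprimed : ∀ k S (j : Fin m) → lookup (rot k S) (unprimed (iterate next j k)) ≡ lookup S (unprimed j)
  lookup-rot-unprimed k S j =
    trans (cong (lookup (rot k S)) (sym (iterate-ρ-unprimed k j))) (lookup-image-to (ρᵖ k) S (unprimed j))

  lookup-rot-primed : ∀ k S (j : Fin m) → lookup (rot k S) (primed (iterate next j k)) ≡ lookup S (primed j)
  lookup-rot-primed k S j =
    trans (cong (lookup (rot k S)) (sym (iterate-ρ-primed k j))) (lookup-image-to (ρᵖ k) S (primed j))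

-- Intersections with a pair, and parity of a size

∣p∣≡0⇒p≡⊥ : ∀ {n} {p : Subset n} → ∣ p ∣ ≡ 0 → p ≡ ⊥
∣p∣≡0⇒p≡⊥ {p = []}        _  = refl
∣p∣≡0⇒p≡⊥ {p = false ∷ p} eq = cong (false ∷_) (∣p∣≡0⇒p≡⊥ eq)

∣⁅a⁆∩p∣ : ∀ {n} (a : Fin n) (p : Subset n) → ∣ ⁅ a ⁆ ∩ p ∣ ≡ bit (lookup p a)
∣⁅a⁆∩p∣ {suc n} zero (true  ∷ p) = cong suc (trans (cong ∣_∣ (∩-zeroˡ p)) (∣⊥∣≡0 n))
∣⁅a⁆∩p∣ {suc n} zero (false ∷ p) = trans (cong ∣_∣ (∩-zeroˡ p)) (∣⊥∣≡0 n)
∣⁅a⁆∩p∣ (suc a) (_ ∷ p)  = ∣⁅a⁆∩p∣ a p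

∣⁅a,b⁆∩p∣ : ∀ {n} {a b : Fin n} → a ≢ b → ∀ (p : Subset n) →
  ∣ (⁅ a ⁆ ∪ ⁅ b ⁆) ∩ p ∣ ≡ bit (lookup p a) + bit (lookup p b)
∣⁅a,b⁆∩p∣ {a = zero}  {zero}  a≢b p = contradiction refl a≢b
∣⁅a,b⁆∩p∣ {a = zero}  {suc b} _ (true  ∷ p) =
  cong suc (trans (cong (λ q → ∣ q ∩ p ∣) (∪-identityˡ ⁅ b ⁆)) (∣⁅a⁆∩p∣ b p))
∣⁅a,b⁆∩p∣ {a = zero}  {suc b} _ (false ∷ p) =
  trans (cong (λ q → ∣ q ∩ p ∣) (∪-identityˡ ⁅ b ⁆)) (∣⁅a⁆∩p∣ b p)
∣⁅a,b⁆∩p∣ {a = suc a} {zero}  _ (true  ∷ p) =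
  trans (cong suc (trans (cong (λ q → ∣ q ∩ p ∣) (∪-identityʳ ⁅ a ⁆)) (∣⁅a⁆∩p∣ a p)))
    (ℕ.+-comm 1 (bit (lookup p a)))
∣⁅a,b⁆∩p∣ {a = suc a} {zero}  _ (false ∷ p) =
  trans (trans (cong (λ q → ∣ q ∩ p ∣) (∪-identityʳ ⁅ a ⁆)) (∣⁅a⁆∩p∣ a p))
    (ℕ.+-comm 0 (bit (lookup p a)))
∣⁅a,b⁆∩p∣ {a = suc a} {suc b} a≢b (_ ∷ p) = ∣⁅a,b⁆∩p∣ (a≢b ∘ cong suc) p

parity-∣updateAt∣ : ∀ {n} (J : Subset n) i → parity ∣ updateAt J i not ∣ ≡ parity ∣ J ∣ ⁻¹
parity-∣updateAt∣ (true  ∷ J) zero    = sym (suc-homo-⁻¹ ∣ J ∣)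
parity-∣updateAt∣ (false ∷ J) zero    = trans (sym (⁻¹-involutive _)) (cong _⁻¹ (suc-homo-⁻¹ ∣ J ∣))
parity-∣updateAt∣ (false ∷ J) (suc i) = parity-∣updateAt∣ J i
parity-∣updateAt∣ (true  ∷ J) (suc i) = begin
  parity (suc ∣ updateAt J i not ∣)          ≡⟨ ⁻¹-involutive _ ⟨
  parity (suc ∣ updateAt J i not ∣) ⁻¹ ⁻¹    ≡⟨ cong _⁻¹ (suc-homo-⁻¹ ∣ updateAt J i not ∣) ⟩
  parity ∣ updateAt J i not ∣ ⁻¹             ≡⟨ cong _⁻¹ (parity-∣updateAt∣ J i) ⟩
  parity ∣ J ∣ ⁻¹ ⁻¹                         ≡⟨ cong _⁻¹ (cong _⁻¹ (suc-homo-⁻¹ ∣ J ∣)) ⟨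
  parity (suc ∣ J ∣) ⁻¹ ⁻¹ ⁻¹                ≡⟨ ⁻¹-involutive _ ⟩
  parity (suc ∣ J ∣) ⁻¹                      ∎
  where open ≡-Reasoning

-- Exchanging j and j′ in a block

module Blocks (m : ℕ) where

  unprimed≢primed : ∀ {i j : Fin m} → unprimed i ≢ primed j
  unprimed≢primed {i} {j} eq
    with () ← trans (sym (splitAt-↑ˡ m i m)) (trans (cong (splitAt m) eq) (splitAt-↑ʳ m m j))

  meet : Subset (E m) → Fin m → ℕ
  meet S i = ∣ (⁅ unprimed i ⁆ ∪ ⁅ primed i ⁆) ∩ S ∣

  meet-bits : ∀ S (i : Fin m) → meet S i ≡ bit (lookup S (unprimed i)) + bit (lookup S (primed i))
  meet-bits S i = ∣⁅a,b⁆∩p∣ unprimed≢primed S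

  infix 4 _~_

  -- This is all that `[ X ∥ Y ]` can see of a block: by `∥-resp-~` and `∥⇒~` it is either empty or
  -- a single class of `~`.
  _~_ : Subset (E m) → Subset (E m) → Set
  S ~ T = ∀ i → meet S i ≡ meet T i

  ~-sym : ∀ {S T} → S ~ T → T ~ S
  ~-sym S~T i = sym (S~T i)

  ~-trans : ∀ {S T U} → S ~ T → T ~ U → S ~ U
  ~-trans S~T T~U i = trans (S~T i) (T~U i)

  ∥-resp-~ : ∀ (X Y : Subset m) {S T} → S ~ T → [ X ∥ Y ] S → [ X ∥ Y ] T
  ∥-resp-~ _ _ S~T (two , zer , one) =
    (λ a a∈X → trans (sym (S~T a)) (two a a∈X)) ,
    (λ b b∈Y → trans (sym (S~T b)) (zer b b∈Y)) ,
    (λ c c∉  → trans (sym (S~T c)) (one c c∉))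

  ∥⇒~ : ∀ (X Y : Subset m) {S T} → [ X ∥ Y ] S → [ X ∥ Y ] T → S ~ T
  ∥⇒~ X Y (two , zer , one) (two′ , zer′ , one′) i with i ∈? X | i ∈? Y
  ... | yes i∈X | _       = trans (two i i∈X) (sym (two′ i i∈X))
  ... | no  _   | yes i∈Y = trans (zer i i∈Y) (sym (zer′ i i∈Y))
  ... | no  i∉X | no  i∉Y = trans (one i i∉) (sym (one′ i i∉))
    where
    i∉ : i ∉ X ∪ Y
    i∉ i∈ = Sum.[ i∉X , i∉Y ] (x∈p∪q⁻ X Y i∈)

  flip : Fin m → Subset (E m) → Subset (E m)
  flip i S =
    tabulate (λ j → lookup S (if does (j ≟ᶠ i) then primed j else unprimed j)) ++
    tabulate (λ j → lookup S (if does (j ≟ᶠ i) then unprimed j else primed j))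

  flip-unprimed : ∀ i S j →
    lookup (flip i S) (unprimed j) ≡ lookup S (if does (j ≟ᶠ i) then primed j else unprimed j)
  flip-unprimed i S j = trans (lookup-++ˡ (tabulate _) (tabulate _) j) (lookup∘tabulate _ j)

  flip-primed : ∀ i S j →
    lookup (flip i S) (primed j) ≡ lookup S (if does (j ≟ᶠ i) then unprimed j else primed j)
  flip-primed i S j = trans (lookup-++ʳ (tabulate (λ j → lookup S (if does (j ≟ᶠ i) then primed j else unprimed j))) (tabulate _) j) (lookup∘tabulate _ j)

  flip-unprimed-≡ : ∀ i S → lookup (flip i S) (unprimed i) ≡ lookup S (primed i)
  flip-unprimed-≡ i S = trans (flip-unprimed i S i)
    (cong (λ b → lookup S (if b then primed i else unprimed i)) (dec-true (i ≟ᶠ i) refl))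

  flip-primed-≡ : ∀ i S → lookup (flip i S) (primed i) ≡ lookup S (unprimed i)
  flip-primed-≡ i S = trans (flip-primed i S i)
    (cong (λ b → lookup S (if b then unprimed i else primed i)) (dec-true (i ≟ᶠ i) refl))

  flip-unprimed-≢ : ∀ {i j} S → j ≢ i → lookup (flip i S) (unprimed j) ≡ lookup S (unprimed j)
  flip-unprimed-≢ {i} {j} S j≢i = trans (flip-unprimed i S j)
    (cong (λ b → lookup S (if b then primed j else unprimed j)) (dec-false (j ≟ᶠ i) j≢i))

  flip-primed-≢ : ∀ {i j} S → j ≢ i → lookup (flip i S) (primed j) ≡ lookup S (primed j)
  flip-primed-≢ {i} {j} S j≢i = trans (flip-primed i S j)
    (cong (λ b → lookup S (if b then unprimed j else primed j)) (dec-false (j ≟ᶠ i) j≢i))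

  flip-involutive : ∀ i S → flip i (flip i S) ≡ S
  flip-involutive i S = E-ext at at′
    where
    at : ∀ j → lookup (flip i (flip i S)) (unprimed j) ≡ lookup S (unprimed j)
    at j with j ≟ᶠ i
    ... | yes refl = trans (flip-unprimed-≡ i (flip i S)) (flip-primed-≡ i S)
    ... | no  j≢i  = trans (flip-unprimed-≢ (flip i S) j≢i) (flip-unprimed-≢ S j≢i)
    at′ : ∀ j → lookup (flip i (flip i S)) (primed j) ≡ lookup S (primed j)
    at′ j with j ≟ᶠ i
    ... | yes refl = trans (flip-primed-≡ i (flip i S)) (flip-unprimed-≡ i S)
    ... | no  j≢i  = trans (flip-primed-≢ (flip i S) j≢i) (flip-primed-≢ S j≢i)

  flip-injective : ∀ i {S T} → flip i S ≡ flip i T → S ≡ T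
  flip-injective i {S} {T} eq =
    trans (sym (flip-involutive i S)) (trans (cong (flip i) eq) (flip-involutive i T))

  flip-~ : ∀ i S → flip i S ~ S
  flip-~ i S j with j ≟ᶠ i
  ... | yes refl = begin
    meet (flip j S) j ≡⟨ meet-bits (flip j S) j ⟩
    _                 ≡⟨ cong₂ (λ a b → bit a + bit b) (flip-unprimed-≡ j S) (flip-primed-≡ j S) ⟩
    _                 ≡⟨ ℕ.+-comm (bit (lookup S (primed j))) _ ⟩
    _                 ≡⟨ meet-bits S j ⟨
    meet S j          ∎
    where open ≡-Reasoning
  ... | no j≢i = begin
    meet (flip i S) j ≡⟨ meet-bits (flip i S) j ⟩
    _                 ≡⟨ cong₂ (λ a b → bit a + bit b) (flip-unprimed-≢ S j≢i) (flip-primed-≢ S j≢i) ⟩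
    _                 ≡⟨ meet-bits S j ⟨
    meet S j          ∎
    where open ≡-Reasoning

  -- These are the sets `F J` with J of either parity, described bit by bit so that the property is
  -- decidable and a map may branch on it.
  Transversal : Pred (Subset (E m)) _
  Transversal S = ∀ (j : Fin m) → lookup S (primed j) ≡ not (lookup S (unprimed j))

  transversal? : Decidable Transversal
  transversal? S = all? λ j → lookup S (primed j) Bool.≟ not (lookup S (unprimed j))

  flip-transversal : ∀ i {S} → Transversal S → Transversal (flip i S)
  flip-transversal i {S} t j with j ≟ᶠ i
  ... | yes refl = trans (flip-primed-≡ j S) (trans (sym (not-involutive _))
                     (cong not (trans (sym (t j)) (sym (flip-unprimed-≡ j S)))))
  ... | no  j≢i  = trans (flip-primed-≢ S j≢i) (trans (t j) (cong not (sym (flip-unprimed-≢ S j≢i))))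

  flip-transversal⁻ : ∀ i {S} → Transversal (flip i S) → Transversal S
  flip-transversal⁻ i {S} t = subst Transversal (flip-involutive i S) (flip-transversal i {flip i S} t)

  F-unprimed : ∀ (J : Subset m) j → lookup (F J) (unprimed j) ≡ lookup J j
  F-unprimed J j = lookup-++ˡ J (∁ J) j

  F-primed : ∀ (J : Subset m) j → lookup (F J) (primed j) ≡ not (lookup J j)
  F-primed J j = trans (lookup-++ʳ J (∁ J) j) (lookup-map j not J)

  F-transversal : ∀ J → Transversal (F J)
  F-transversal J j = trans (F-primed J j) (cong not (sym (F-unprimed J j)))

  flip-F : ∀ i (J : Subset m) → flip i (F J) ≡ F (updateAt J i not)
  flip-F i J = E-ext at at′
    where
    at : ∀ j → lookup (flip i (F J)) (unprimed j) ≡ lookup (F (updateAt J i not)) (unprimed j)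
    at j = trans (at″ (j ≟ᶠ i)) (sym (F-unprimed (updateAt J i not) j))
      where
      at″ : Dec (j ≡ i) → lookup (flip i (F J)) (unprimed j) ≡ lookup (updateAt J i not) j
      at″ (yes refl) = trans (flip-unprimed-≡ i (F J)) (trans (F-primed J i) (sym (lookup∘updateAt i J)))
      at″ (no  j≢i)  = trans (flip-unprimed-≢ (F J) j≢i)
                         (trans (F-unprimed J j) (sym (lookup∘updateAt′ j i j≢i J)))
    at′ : ∀ j → lookup (flip i (F J)) (primed j) ≡ lookup (F (updateAt J i not)) (primed j)
    at′ j = trans (flip-transversal i {F J} (F-transversal J) j)
      (trans (cong not (at j)) (sym (F-transversal (updateAt J i not) j)))

  -- `𝓕ₚ 1ℙ` and `𝓕ₚ 0ℙ` unfold to `𝓕₁ m` and `𝓕₂ m`. With the parity as an index, one argument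
  -- serves both systems, and a single flip is a step from p to `p ⁻¹`.
  𝓕ₚ : Parity → SetSystem (E m)
  𝓕ₚ p S = ∃ λ (J : Subset m) → parity ∣ J ∣ ≡ p × S ≡ F J

  𝓕ₚ-transversal : ∀ {p S} → 𝓕ₚ p S → Transversal S
  𝓕ₚ-transversal (J , _ , refl) = F-transversal J

  𝓕ₚ-flip : ∀ {p} i {S} → 𝓕ₚ p S → 𝓕ₚ (p ⁻¹) (flip i S)
  𝓕ₚ-flip i (J , refl , refl) = updateAt J i not , parity-∣updateAt∣ J i , flip-F i J

  module Exchange {l o : Fin m} (l≢o : l ≢ o) where

    -- Exchanging l and l′ must be compensated by a second exchange on the
    -- transversals, where a single one would change the parity.
    exchangeIf : Bool → Subset (E m) → Subset (E m)
    exchangeIf true  S = flip o (flip l S)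
    exchangeIf false S = flip l S

    exchange : Subset (E m) → Subset (E m)
    exchange S = exchangeIf (does (transversal? S)) S

    -- Either branch is composed of flips, so the class is kept without knowing which one applies.
    -- This settles the blocks from Ω.
    exchange-~ : ∀ S → exchange S ~ S
    exchange-~ S = by (does (transversal? S))
      where
      by : ∀ b → exchangeIf b S ~ S
      by true  = ~-trans {flip o (flip l S)} {flip l S} {S} (flip-~ o (flip l S)) (flip-~ l S)
      by false = flip-~ l S

    exchange-𝓕ₚ : ∀ {p S} → 𝓕ₚ p S → 𝓕ₚ p (exchange S)
    exchange-𝓕ₚ {p} {S} S∈ =
      subst (λ b → 𝓕ₚ p (exchangeIf b S)) (sym (dec-true (transversal? S) (𝓕ₚ-transversal S∈)))
        (subst (λ p → 𝓕ₚ p (flip o (flip l S))) (⁻¹-involutive p) (𝓕ₚ-flip o (𝓕ₚ-flip l S∈)))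

    exchange-unprimed : ∀ S → lookup (exchange S) (unprimed l) ≡ lookup S (primed l)
    exchange-unprimed S = by (does (transversal? S))
      where
      by : ∀ b → lookup (exchangeIf b S) (unprimed l) ≡ lookup S (primed l)
      by true  = trans (flip-unprimed-≢ (flip l S) l≢o) (flip-unprimed-≡ l S)
      by false = flip-unprimed-≡ l S

    exchange-primed : ∀ S → lookup (exchange S) (primed l) ≡ lookup S (unprimed l)
    exchange-primed S = by (does (transversal? S))
      where
      by : ∀ b → lookup (exchangeIf b S) (primed l) ≡ lookup S (unprimed l)
      by true  = trans (flip-primed-≢ (flip l S) l≢o) (flip-primed-≡ l S)
      by false = flip-primed-≡ l S

    exchangeIf-transversal : ∀ b {S} → Transversal S → Transversal (exchangeIf b S)
    exchangeIf-transversal true  {S} t = flip-transversal o {flip l S} (flip-transversal l {S} t)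
    exchangeIf-transversal false {S} t = flip-transversal l {S} t

    exchangeIf-transversal⁻ : ∀ b {S} → Transversal (exchangeIf b S) → Transversal S
    exchangeIf-transversal⁻ true  {S} t = flip-transversal⁻ l {S} (flip-transversal⁻ o {flip l S} t)
    exchangeIf-transversal⁻ false {S} t = flip-transversal⁻ l {S} t

    exchange-transversal : ∀ S → Transversal S → Transversal (exchange S)
    exchange-transversal S = exchangeIf-transversal (does (transversal? S)) {S}

    -- Each branch is built from involutions. Values of different branches cannot coincide, because
    -- flips both preserve and reflect transversality.
    exchange-injective : ∀ {S T} → exchange S ≡ exchange T → S ≡ T
    exchange-injective {S} {T} = by (transversal? S) (transversal? T)
      where
      by : (s? : Dec (Transversal S)) (t? : Dec (Transversal T)) →
        exchangeIf (does s?) S ≡ exchangeIf (does t?) T → S ≡ T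
      by (yes _) (yes _) eq = flip-injective l (flip-injective o eq)
      by (no  _) (no  _) eq = flip-injective l eq
      by (yes s) (no ¬t) eq = contradiction
        (exchangeIf-transversal⁻ false {T} (subst Transversal eq (exchangeIf-transversal true {S} s))) ¬t
      by (no ¬s) (yes t) eq = contradiction
        (exchangeIf-transversal⁻ false {S} (subst Transversal (sym eq) (exchangeIf-transversal true {T} t))) ¬s

    toUnprimed : Subset (E m) → Subset (E m)
    toUnprimed S = if lookup S (unprimed l) then S else exchange S

    toUnprimed-∈ : ∀ {S} → lookup S (unprimed l) ≡ true → toUnprimed S ≡ S
    toUnprimed-∈ {S} = cong (if_then S else exchange S)

    toUnprimed-∉ : ∀ {S} → lookup S (unprimed l) ≡ false → toUnprimed S ≡ exchange S
    toUnprimed-∉ {S} = cong (if_then S else exchange S)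

    -- On a block through l′ the value still contains l′ exactly when the block was left alone. So
    -- the value reveals the branch, which is what injectivity of `toUnprimed` rests on.
    toUnprimed-primed : ∀ S → lookup S (primed l) ≡ true →
      lookup (toUnprimed S) (primed l) ≡ lookup S (unprimed l)
    toUnprimed-primed S l′∈S = by _ refl
      where
      by : ∀ b → lookup S (unprimed l) ≡ b → lookup (toUnprimed S) (primed l) ≡ lookup S (unprimed l)
      by true  eq = trans (cong (λ T → lookup T (primed l)) (toUnprimed-∈ {S} eq)) (trans l′∈S (sym eq))
      by false eq = trans (cong (λ T → lookup T (primed l)) (toUnprimed-∉ {S} eq)) (exchange-primed S)

    toUnprimed-injective : ∀ {S T} → lookup S (primed l) ≡ true → lookup T (primed l) ≡ true →
      toUnprimed S ≡ toUnprimed T → S ≡ T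
    toUnprimed-injective {S} {T} l′∈S l′∈T eq = by _ refl
      where
      same : lookup T (unprimed l) ≡ lookup S (unprimed l)
      same = trans (sym (toUnprimed-primed T l′∈T))
        (trans (cong (λ U → lookup U (primed l)) (sym eq)) (toUnprimed-primed S l′∈S))
      by : ∀ b → lookup S (unprimed l) ≡ b → S ≡ T
      by true  l∈S = trans (sym (toUnprimed-∈ {S} l∈S)) (trans eq (toUnprimed-∈ {T} (trans same l∈S)))
      by false l∉S = exchange-injective
        (trans (sym (toUnprimed-∉ {S} l∉S)) (trans eq (toUnprimed-∉ {T} (trans same l∉S))))

-- The systems ⟨ X ∥ Y ⟩

module Orbits (n : ℕ) where

  open Rotation n public
  open Blocks m public

  -- The positions `iterate next j k` exhaust `Fin m`, and they are the ones at which a block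
  -- rotated by k can be read off directly.
  E-ext-next : ∀ k {S T : Subset (E m)} →
    (∀ (j : Fin m) → lookup S (unprimed (iterate next j k)) ≡ lookup T (unprimed (iterate next j k))) →
    (∀ (j : Fin m) → lookup S (primed (iterate next j k)) ≡ lookup T (primed (iterate next j k))) → S ≡ T
  E-ext-next k {S} {T} h h′ = E-ext
    (λ j → subst (λ i → lookup S (unprimed i) ≡ lookup T (unprimed i)) (inverseʳ (nextᵖ k)) (h _))
    (λ j → subst (λ i → lookup S (primed i) ≡ lookup T (primed i)) (inverseʳ (nextᵖ k)) (h′ _))

  rot-F : ∀ k J → rot k (F J) ≡ F (image (nextᵖ k ⟨$⟩ʳ_) J)
  rot-F k J = E-ext-next k
    (λ j → begin
      lookup (rot k (F J)) (unprimed (π j)) ≡⟨ lookup-rot-unprimed k (F J) j ⟩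
      lookup (F J) (unprimed j)             ≡⟨ F-unprimed J j ⟩
      lookup J j                            ≡⟨ lookup-image-to (nextᵖ k) J j ⟨
      lookup (image π J) (π j)              ≡⟨ F-unprimed (image π J) (π j) ⟨
      lookup (F (image π J)) (unprimed (π j)) ∎)
    (λ j → begin
      lookup (rot k (F J)) (primed (π j))   ≡⟨ lookup-rot-primed k (F J) j ⟩
      lookup (F J) (primed j)               ≡⟨ F-primed J j ⟩
      not (lookup J j)                      ≡⟨ cong not (lookup-image-to (nextᵖ k) J j) ⟨
      not (lookup (image π J) (π j))        ≡⟨ F-primed (image π J) (π j) ⟨
      lookup (F (image π J)) (primed (π j)) ∎)
    where
    open ≡-Reasoning
    π : Fin m → Fin m
    π = nextᵖ k ⟨$⟩ʳ_

  meet-rot : ∀ k S (j : Fin m) → meet (rot k S) (iterate next j k) ≡ meet S j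
  meet-rot k S j = begin
    meet (rot k S) (iterate next j k) ≡⟨ meet-bits (rot k S) (iterate next j k) ⟩
    _                 ≡⟨ cong₂ (λ a b → bit a + bit b) (lookup-rot-unprimed k S j) (lookup-rot-primed k S j) ⟩
    _                 ≡⟨ meet-bits S j ⟨
    meet S j          ∎
    where open ≡-Reasoning

  rot-~ : ∀ k {S T} → S ~ T → rot k S ~ rot k T
  rot-~ k {S} {T} S~T j = subst (λ i → meet (rot k S) i ≡ meet (rot k T) i) (inverseʳ (nextᵖ k) {j})
    (trans (meet-rot k S i) (trans (S~T i) (sym (meet-rot k T i))))
    where
    i : Fin m
    i = nextᵖ k ⟨$⟩ˡ j

  -- Rotating T back by the same amount gives a set in the `~`-class of U, hence in `[ X ∥ Y ]`.
  ⟨∥⟩-resp-~ : ∀ (X Y : Subset m) {S T} → S ~ T → ⟨ X ∥ Y ⟩ S → ⟨ X ∥ Y ⟩ T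
  ⟨∥⟩-resp-~ X Y {T = T} S~T (q , U , U∈ , refl) =
    subst ⟨ X ∥ Y ⟩ (rot-inverse′ T) (rot∈orbit k (∥-resp-~ X Y {U} U~ U∈))
    where
    k : ℕ
    k = label q
    rot-inverse′ : ∀ T → rot k (rot (k * n) T) ≡ T
    rot-inverse′ T = trans (rot-+ (k * n) k T)
      (trans (cong (λ t → rot t T) (trans (ℕ.+-comm (k * n) k) (sym (ℕ.*-suc k n)))) (rot-period k T))
    U~ : U ~ rot (k * n) T
    U~ = subst (_~ rot (k * n) T) (rot-inverse k U) (rot-~ (k * n) {rot k U} {T} S~T)

  -- One common block suffices. Up to rotation all blocks of `⟨ X ∥ Y ⟩` lie in one `~`-class, and
  -- `⟨ X′ ∥ Y′ ⟩` is closed under both `~` and rotation.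
  ⟨∥⟩-⊆ : ∀ {X Y X′ Y′ : Subset m} {S} → ⟨ X ∥ Y ⟩ S → ⟨ X′ ∥ Y′ ⟩ S → ⟨ X ∥ Y ⟩ ⊆ ⟨ X′ ∥ Y′ ⟩
  ⟨∥⟩-⊆ {X} {Y} {X′} {Y′} (q , U , U∈ , refl) S∈′ (r , V , V∈ , refl) =
    subst ⟨ X′ ∥ Y′ ⟩ (cong (rot (label r)) (rot-inverse (label q) V))
      (orbit-rot (label r) (orbit-rot (label q * n)
        (⟨∥⟩-resp-~ X′ Y′ {rot (label q) U} {rot (label q) V} (rot-~ (label q) {U} {V} (∥⇒~ X Y U∈ V∈)) S∈′)))

  ⟨∥⟩-≐ : ∀ {X Y X′ Y′ : Subset m} {S} → ⟨ X ∥ Y ⟩ S → ⟨ X′ ∥ Y′ ⟩ S → ⟨ X ∥ Y ⟩ ≐ ⟨ X′ ∥ Y′ ⟩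
  ⟨∥⟩-≐ S∈ S∈′ = ⟨∥⟩-⊆ S∈ S∈′ , ⟨∥⟩-⊆ S∈′ S∈

  -- The part of 𝓗 m that comes from Ω.
  𝒪 : SetSystem (E m)
  𝒪 J = ∃₂ λ (X Y : Subset m) →
      InΩ X Y
    × ¬ (⟨ X ∥ Y ⟩ ≐ ⟨ C m ∥ C+1 m ⟩)
    × ¬ (⟨ X ∥ Y ⟩ ≐ ⟨ C+1 m ∥ C m ⟩)
    × sgn X Y ≐ ｛ β ｝
    × ⟨ X ∥ Y ⟩ J

  𝒪-resp-~ : ∀ {S T} → S ~ T → 𝒪 S → 𝒪 T
  𝒪-resp-~ {S} {T} S~T (X , Y , inΩ , ≠₁ , ≠₂ , s , S∈) = X , Y , inΩ , ≠₁ , ≠₂ , s , ⟨∥⟩-resp-~ X Y {S} {T} S~T S∈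

  𝒪-rot : ∀ k {S} → 𝒪 S → 𝒪 (rot k S)
  𝒪-rot k (X , Y , inΩ , ≠₁ , ≠₂ , s , S∈) = X , Y , inΩ , ≠₁ , ≠₂ , s , orbit-rot k S∈

  -- A position in X needs its primed copy, so a block without primed elements forces X to be empty.
  -- Then Y is empty because it has the same size, and Ω leaves out `⟨ ⊥ ∥ ⊥ ⟩`.
  𝒪-primed : ∀ {S} → 𝒪 S → ¬ (∀ (j : Fin m) → lookup S (primed j) ≡ false)
  𝒪-primed (X , Y , (∣X∣≡∣Y∣ , _ , ≠⊥) , _ , _ , _ , (q , U , (two , _) , refl)) none =
    ≠⊥ (subst₂ (λ X′ Y′ → ⟨ X′ ∥ Y′ ⟩ ≐ ⟨_∥_⟩ {m} ⊥ ⊥) (sym X≡⊥) (sym Y≡⊥) (id , id))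
    where
    X≡⊥ : X ≡ ⊥
    X≡⊥ = Empty-unique λ (a , a∈X) → bit≢2 (lookup U (unprimed a)) (begin
      bit (lookup U (unprimed a)) + 0                           ≡⟨ cong (λ b → bit (lookup U (unprimed a)) + bit b)
                                                                     (trans (sym (lookup-rot-primed (label q) U a)) (none _)) ⟨
      bit (lookup U (unprimed a)) + bit (lookup U (primed a))   ≡⟨ meet-bits U a ⟨
      meet U a                                                  ≡⟨ two a a∈X ⟩
      2                                                         ∎)
      where
      open ≡-Reasoning
      bit≢2 : ∀ b → bit b + 0 ≢ 2
      bit≢2 true  ()
      bit≢2 false ()
    Y≡⊥ : Y ≡ ⊥
    Y≡⊥ = ∣p∣≡0⇒p≡⊥ (trans (sym ∣X∣≡∣Y∣) (trans (cong ∣_∣ X≡⊥) (∣⊥∣≡0 m)))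

  𝒮ₚ : Parity → SetSystem (E m)
  𝒮ₚ p = 𝓗 m ∪ᵖ 𝓕ₚ p

  𝓕ₚ-rot : ∀ {p} k {S} → 𝓕ₚ p S → 𝓕ₚ p (rot k S)
  𝓕ₚ-rot k (J , par , refl) =
    image (nextᵖ k ⟨$⟩ʳ_) J , trans (cong parity (∣image∣ (nextᵖ k) J)) par , rot-F k J

  𝒮ₚ-rot : ∀ {p} k {S} → 𝒮ₚ p S → 𝒮ₚ p (rot k S)
  𝒮ₚ-rot k (inj₁ (inj₁ S∈)) = inj₁ (inj₁ (orbit-rot k S∈))
  𝒮ₚ-rot k (inj₁ (inj₂ S∈)) = inj₁ (inj₂ (𝒪-rot k S∈))
  𝒮ₚ-rot k (inj₂ S∈)        = inj₂ (𝓕ₚ-rot k S∈)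

  _through_ : SetSystem (E m) → Fin (E m) → SetSystem (E m)
  (𝒜 through e) S = 𝒜 S × lookup S e ≡ true

  through-rot : ∀ {p} k e → 𝒮ₚ p through e ≼ 𝒮ₚ p through (iterate (ρ m) e k)
  through-rot k e = record
    { to        = rot k
    ; maps      = λ {S} (S∈ , e∈S) → 𝒮ₚ-rot k S∈ , trans (lookup-image-to (ρᵖ k) S e) e∈S
    ; injective = λ _ _ → image-injective (ρᵖ k)
    }

  through-unprimed : ∀ {p} (i j : Fin m) → 𝒮ₚ p through unprimed i ≼ 𝒮ₚ p through unprimed j
  through-unprimed {p} i j with k , refl ← next-transitive i j =
    subst (λ e → 𝒮ₚ p through unprimed i ≼ 𝒮ₚ p through e) (iterate-ρ-unprimed k i) (through-rot k (unprimed i))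

  through-primed : ∀ {p} (i j : Fin m) → 𝒮ₚ p through primed i ≼ 𝒮ₚ p through primed j
  through-primed {p} i j with k , refl ← next-transitive i j =
    subst (λ e → 𝒮ₚ p through primed i ≼ 𝒮ₚ p through e) (iterate-ρ-primed k i) (through-rot k (primed i))

-- The sets `last m`, `C m`, `C+1 m` and the blocks `A m`, `B m`

lookup-⟦⟧-true : ∀ {n} {P : Pred (Fin n) 0ℓ} (P? : Decidable P) {i} → P i → lookup ⟦ P? ⟧ i ≡ true
lookup-⟦⟧-true P? {i} Pi = trans (lookup∘tabulate _ i) (dec-true (P? i) Pi)

lookup-⟦⟧-false : ∀ {n} {P : Pred (Fin n) 0ℓ} (P? : Decidable P) {i} → ¬ P i → lookup ⟦ P? ⟧ i ≡ false
lookup-⟦⟧-false P? {i} ¬Pi = trans (lookup∘tabulate _ i) (dec-false (P? i) ¬Pi)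

lookup-true-⟦⟧ : ∀ {n} {P : Pred (Fin n) 0ℓ} (P? : Decidable P) {i} → lookup ⟦ P? ⟧ i ≡ true → P i
lookup-true-⟦⟧ P? {i} eq with P? i in eq′
... | yes Pi = Pi
... | no _   = contradiction (trans (sym (cong does eq′)) (trans (sym (lookup∘tabulate _ i)) eq)) false≢true

module Critical (k : ℕ) (m-odd : Odd (3 + k)) where

  open Orbits (2 + k)

  even≢odd : 0ℙ ≢ 1ℙ
  even≢odd ()

  odd⇒even-pred : ∀ j → parity (suc j) ≡ 1ℙ → parity j ≡ 0ℙ
  odd⇒even-pred j eq = trans (sym (suc-homo-⁻¹ j)) (cong _⁻¹ eq)

  even⇒odd-pred : ∀ j → parity (suc j) ≡ 0ℙ → parity j ≡ 1ℙ
  even⇒odd-pred j eq = trans (sym (suc-homo-⁻¹ j)) (cong _⁻¹ eq)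

  InC : Pred (Fin m) 0ℓ
  InC i = parity (label i) ≡ 1ℙ × label i ≤ m ∸ 2

  inC? : Decidable InC
  inC? i = (parity (label i) ≟ᵖ 1ℙ) ×-dec (label i ℕ.≤? m ∸ 2)

  InC+1 : Pred (Fin m) 0ℓ
  InC+1 i = ∃ λ a → a ∈ C m × next a ≡ i

  inC+1? : Decidable InC+1
  inC+1? i = any? λ a → (a ∈? C m) ×-dec (next a ≟ᶠ i)

  last? : Decidable (λ (i : Fin m) → label i ≡ m)
  last? i = label i ℕ.≟ m

  InC+1⇒even : ∀ {i} → InC+1 i → parity (label i) ≡ 0ℙ
  InC+1⇒even (a , a∈C , refl) = even (lookup-true-⟦⟧ inC? ([]=⇒lookup a∈C))
    where
    even : InC a → parity (label (next a)) ≡ 0ℙ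
    even (odd , a≤) = trans
      (cong (λ t → parity (suc t)) (trans (toℕ-next a) (m<n⇒m%n≡m (s≤s (ℕ.m≤n⇒m≤1+n a≤)))))
      (odd⇒even-pred (toℕ a) odd)

  even⇒InC+1 : ∀ {i} → parity (label i) ≡ 0ℙ → InC+1 i
  -- Index zero has the odd label 1. An even label differs from the odd m, so its predecessor is an
  -- odd label of at most m - 2.
  even⇒InC+1 {suc i} even = a , lookup⇒[]= a (C m) (lookup-⟦⟧-true inC? (odd , a≤)) , toℕ-injective (begin
    toℕ (next a)                  ≡⟨ trans (toℕ-next a) (m<n⇒m%n≡m (s≤s (ℕ.m≤n⇒m≤1+n a≤))) ⟩
    suc (toℕ a)                   ≡⟨ cong suc toℕ-a ⟩
    suc (toℕ i)                   ∎)
    where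
    open ≡-Reasoning
    a : Fin m
    a = inject₁ i
    toℕ-a : toℕ a ≡ toℕ i
    toℕ-a = toℕ-inject₁ i
    odd : parity (label a) ≡ 1ℙ
    odd = trans (cong (parity ∘ suc) toℕ-a) (even⇒odd-pred (suc (toℕ i)) even)
    label≢m : label (suc i) ≢ m
    label≢m eq = even≢odd (trans (sym even) (trans (cong parity eq) m-odd))
    a≤ : label a ≤ m ∸ 2
    a≤ = subst (λ t → suc t ≤ m ∸ 2) (sym toℕ-a)
      (ℕ.≤-pred (ℕ.≤-pred (ℕ.≤∧≢⇒< (toℕ<n (suc i)) label≢m)))

  -- The only other label above m - 2 is m - 1, which is even.
  odd⇒≤ : ∀ {i : Fin m} → parity (label i) ≡ 1ℙ → label i ≢ m → label i ≤ m ∸ 2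
  odd⇒≤ {i} odd ≢m = ℕ.≤∧≢⇒< (ℕ.≤-pred (ℕ.≤∧≢⇒< (ℕ.≤-pred (toℕ<n i)) (≢m ∘ cong suc))) ≢m-2
    where
    ≢m-2 : toℕ i ≢ m ∸ 2
    ≢m-2 eq = even≢odd (trans (sym (odd⇒even-pred (2 + k) m-odd)) (trans (sym (cong (parity ∘ suc) eq)) odd))

  -- For odd m the three sets partition [m] into m, the even labels and the remaining odd labels.
  -- With the three bits as indices, matching on a class evaluates every Boolean expression in them.
  data Class (i : Fin m) : (inLast inC+1 inC : Bool) → Set where
    isLast : label i ≡ m → Class i true false false
    isC+1  : parity (label i) ≡ 0ℙ → Class i false true false
    isC    : parity (label i) ≡ 1ℙ → label i ≤ m ∸ 2 → Class i false false true

  lookups : ∀ i → Class i (lookup (last m) i) (lookup (C+1 m) i) (lookup (C m) i)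
  lookups i = by (parity (label i)) refl (last? i)
    where
    Class-subst : ∀ {a a′ b b′ c c′} → a ≡ a′ → b ≡ b′ → c ≡ c′ → Class i a′ b′ c′ → Class i a b c
    Class-subst refl refl refl cl = cl
    by : ∀ p → parity (label i) ≡ p → Dec (label i ≡ m) →
      Class i (lookup (last m) i) (lookup (C+1 m) i) (lookup (C m) i)
    ¬both : parity (label i) ≡ 0ℙ → parity (label i) ≢ 1ℙ
    ¬both even odd = even≢odd (trans (sym even) odd)
    by 0ℙ even _ = Class-subst
      (lookup-⟦⟧-false last? {i} λ eq → ¬both even (subst (λ j → parity j ≡ 1ℙ) (sym eq) m-odd))
      (lookup-⟦⟧-true inC+1? {i} (even⇒InC+1 {i} even))
      (lookup-⟦⟧-false inC? {i} λ (odd , _) → ¬both even odd)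
      (isC+1 even)
    by 1ℙ odd (yes eq) = Class-subst
      (lookup-⟦⟧-true last? {i} eq)
      (lookup-⟦⟧-false inC+1? {i} λ c → ¬both (InC+1⇒even {i} c) odd)
      (lookup-⟦⟧-false inC? {i} λ (_ , le) → ℕ.<⇒≱ (ℕ.m≤n+m (suc (m ∸ 2)) 1) (subst (_≤ m ∸ 2) eq le))
      (isLast eq)
    by 1ℙ odd (no neq) = Class-subst
      (lookup-⟦⟧-false last? {i} neq)
      (lookup-⟦⟧-false inC+1? {i} λ c → ¬both (InC+1⇒even {i} c) odd)
      (lookup-⟦⟧-true inC? {i} (odd , odd⇒≤ {i} odd neq))
      (isC odd (odd⇒≤ {i} odd neq))

  A-unprimed : ∀ i → lookup (A m) (unprimed i) ≡ lookup (last m) i ∨ lookup (C+1 m) i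
  A-unprimed i = trans (lookup-++ˡ (last m ∪ C+1 m) (C+1 m) i) (lookup-zipWith _∨_ i (last m) (C+1 m))

  A-primed : ∀ i → lookup (A m) (primed i) ≡ lookup (C+1 m) i
  A-primed i = lookup-++ʳ (last m ∪ C+1 m) (C+1 m) i

  B-unprimed : ∀ i → lookup (B m) (unprimed i) ≡ lookup (last m) i ∨ lookup (C m) i
  B-unprimed i = trans (lookup-++ˡ (last m ∪ C m) (C m) i) (lookup-zipWith _∨_ i (last m) (C m))

  B-primed : ∀ i → lookup (B m) (primed i) ≡ lookup (C m) i
  B-primed i = lookup-++ʳ (last m ∪ C m) (C m) i

  meet-A : ∀ i → meet (A m) i ≡ bit (lookup (last m) i ∨ lookup (C+1 m) i) + bit (lookup (C+1 m) i)
  meet-A i = trans (meet-bits (A m) i) (cong₂ (λ a b → bit a + bit b) (A-unprimed i) (A-primed i))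

  -- `A m` has both copies of each even label, neither copy of a label in `C m`, and only the
  -- unprimed copy of m.
  A∈⟨C+1∥C⟩ : ⟨ C+1 m ∥ C m ⟩ (A m)
  A∈⟨C+1∥C⟩ = ⊆orbit
    ( (λ i i∈ → trans (meet-A i) (two (lookups i) ([]=⇒lookup i∈)))
    , (λ i i∈ → trans (meet-A i) (none (lookups i) ([]=⇒lookup i∈)))
    , (λ i i∉ → trans (meet-A i) (one (lookups i)
        (λ eq → i∉ (x∈p∪q⁺ {p = C+1 m} {q = C m} (inj₁ (lookup⇒[]= i _ eq))))
        (λ eq → i∉ (x∈p∪q⁺ {p = C+1 m} {q = C m} (inj₂ (lookup⇒[]= i _ eq)))))) )
    where
    two : ∀ {i a b c} → Class i a b c → b ≡ true → bit (a ∨ b) + bit b ≡ 2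
    two (isC+1 _) refl = refl
    none : ∀ {i a b c} → Class i a b c → c ≡ true → bit (a ∨ b) + bit b ≡ 0
    none (isC _ _) refl = refl
    one : ∀ {i a b c} → Class i a b c → b ≢ true → c ≢ true → bit (a ∨ b) + bit b ≡ 1
    one (isLast _) _  _  = refl
    one (isC+1 _)  ≢b _  = contradiction refl ≢b
    one (isC _ _)  _  ≢c = contradiction refl ≢c

  AB : SetSystem (E m)
  AB = orbit m (｛ A m ｝ ∪ᵖ ｛ B m ｝)

  rotated-primed : ∀ q {S} → (∀ (j : Fin m) → lookup S (primed j) ≡ true → lookup S (unprimed j) ≡ true) →
    ∀ (j : Fin m) → lookup (rot q S) (primed j) ≡ true → lookup (rot q S) (unprimed j) ≡ true
  rotated-primed q {S} h j = subst (λ i → lookup (rot q S) (primed i) ≡ true → lookup (rot q S) (unprimed i) ≡ true)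
    (inverseʳ (nextᵖ q) {j})
    (λ eq → trans (lookup-rot-unprimed q S i) (h i (trans (sym (lookup-rot-primed q S i)) eq)))
    where
    i : Fin m
    i = nextᵖ q ⟨$⟩ˡ j

  -- In `A m` and `B m` the unprimed half is the primed half with m added, and rotation acts on both
  -- halves alike.
  AB-primed⇒unprimed : ∀ {S} → AB S → ∀ (j : Fin m) →
    lookup S (primed j) ≡ true → lookup S (unprimed j) ≡ true
  AB-primed⇒unprimed (q , S , inj₁ refl , refl) = rotated-primed (label q) {A m} λ j eq →
    trans (A-unprimed j) (trans (cong (lookup (last m) j ∨_) (trans (sym (A-primed j)) eq)) (∨-zeroʳ (lookup (last m) j)))
  AB-primed⇒unprimed (q , S , inj₂ refl , refl) = rotated-primed (label q) {B m} λ j eq →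
    trans (B-unprimed j) (trans (cong (lookup (last m) j ∨_) (trans (sym (B-primed j)) eq)) (∨-zeroʳ (lookup (last m) j)))

  l : Fin m
  l = fromℕ (2 + k)

  A-l : lookup (A m) (unprimed l) ≡ true × lookup (A m) (primed l) ≡ false
  A-l = trans (A-unprimed l) (proj₁ here) , trans (A-primed l) (proj₂ here)
    where
    label-l : label l ≡ m
    label-l = cong suc (toℕ-fromℕ (2 + k))
    at : ∀ {a b c} → Class l a b c → a ∨ b ≡ true × b ≡ false
    at (isLast _) = refl , refl
    at (isC+1 even) = contradiction (trans (sym even) (trans (cong parity label-l) m-odd)) even≢odd
    at (isC _ le) = contradiction (subst (_≤ m ∸ 2) label-l le) (ℕ.<⇒≱ (ℕ.m≤n+m (suc (m ∸ 2)) 1))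
    here = at (lookups l)

  -- The numerals in this name and in `0∈C` are indices; the labels are 2 and 1.
  1∈C+1 : lookup (C+1 m) (suc zero) ≡ true
  1∈C+1 = at (lookups (suc zero))
    where
    at : ∀ {a b c} → Class (suc zero) a b c → b ≡ true
    at (isC+1 _) = refl
    at (isLast ())
    at (isC () _)

  0∈C : lookup (C m) zero ≡ true
  0∈C = lookup-⟦⟧-true inC? (refl , s≤s z≤n)

  AB-primed : ∀ {S} → AB S → ¬ (∀ (j : Fin m) → lookup S (primed j) ≡ false)
  AB-primed (q , S , inj₁ refl , refl) none = false≢true
    (trans (sym (none _)) (trans (lookup-rot-primed (label q) (A m) (suc zero)) (trans (A-primed (suc zero)) 1∈C+1)))
  AB-primed (q , S , inj₂ refl , refl) none = false≢true
    (trans (sym (none _)) (trans (lookup-rot-primed (label q) (B m) zero) (trans (B-primed zero) 0∈C)))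

  A-¬transversal : ¬ Transversal (A m)
  A-¬transversal t = false≢true (trans (cong not (sym both)) (trans (sym (t (suc zero))) (trans (A-primed (suc zero)) 1∈C+1)))
    where
    both : lookup (A m) (unprimed {m} (suc zero)) ≡ true
    both = trans (A-unprimed (suc zero)) (trans (cong (lookup (last m) (suc zero) ∨_) 1∈C+1) (∨-zeroʳ (lookup (last m) (suc zero))))

  A∉𝒪 : ¬ 𝒪 (A m)
  A∉𝒪 (X , Y , _ , _ , ≠⟨C+1∥C⟩ , _ , A∈) = ≠⟨C+1∥C⟩ (⟨∥⟩-≐ A∈ A∈⟨C+1∥C⟩)

  -- More blocks through m than through m′

  open Exchange {l} {zero} (λ ())

  toUnprimed-𝒮ₚ : ∀ {p S} → 𝒮ₚ p S → lookup S (primed l) ≡ true →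
    𝒮ₚ p (toUnprimed S) × lookup (toUnprimed S) (unprimed l) ≡ true
  toUnprimed-𝒮ₚ {p} {S} S∈ l′∈S = by _ refl
    where
    moved : lookup S (unprimed l) ≡ false → 𝒮ₚ p S → 𝒮ₚ p (exchange S)
    moved eq (inj₁ (inj₁ S∈)) = contradiction (trans (sym eq) (AB-primed⇒unprimed S∈ l l′∈S)) false≢true
    moved eq (inj₁ (inj₂ S∈)) = inj₁ (inj₂ (𝒪-resp-~ {S} {exchange S} (~-sym {exchange S} {S} (exchange-~ S)) S∈))
    moved eq (inj₂ S∈)        = inj₂ (exchange-𝓕ₚ S∈)
    Goal : Subset (E m) → Set
    Goal T = 𝒮ₚ p T × lookup T (unprimed l) ≡ true
    by : ∀ b → lookup S (unprimed l) ≡ b → Goal (toUnprimed S)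
    by true  eq = subst Goal (sym (toUnprimed-∈ {S} eq)) (S∈ , eq)
    by false eq = subst Goal (sym (toUnprimed-∉ {S} eq)) (moved eq S∈ , trans (exchange-unprimed S) l′∈S)

  -- No source is possible. Rotations of `A m` and `B m` contain l along with l′; a block from Ω
  -- would place `A m` in `𝒪`; a transversal would make `A m` transversal, yet it contains both 2
  -- and 2′.
  exchange≢A : ∀ {p S} → 𝒮ₚ p S → lookup S (primed l) ≡ true → lookup S (unprimed l) ≡ false → exchange S ≢ A m
  exchange≢A {S = S} (inj₁ (inj₁ S∈)) l′∈S l∉S eq = false≢true (trans (sym l∉S) (AB-primed⇒unprimed S∈ l l′∈S))
  exchange≢A {S = S} (inj₁ (inj₂ S∈)) l′∈S l∉S eq =
    A∉𝒪 (subst 𝒪 eq (𝒪-resp-~ {S} {exchange S} (~-sym {exchange S} {S} (exchange-~ S)) S∈))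
  exchange≢A {S = S} (inj₂ S∈)        l′∈S l∉S eq =
    A-¬transversal (subst Transversal eq (exchange-transversal S (𝓕ₚ-transversal S∈)))

  toUnprimed≢A : ∀ {p S} → 𝒮ₚ p S → lookup S (primed l) ≡ true → toUnprimed S ≢ A m
  toUnprimed≢A {S = S} S∈ l′∈S eqA = by _ refl
    where
    by : ∀ b → lookup S (unprimed l) ≢ b
    -- A block left alone keeps l′, which `A m` lacks.
    by true  eq = false≢true (trans (sym (proj₂ A-l))
      (trans (cong (λ T → lookup T (primed l)) (trans (sym eqA) (toUnprimed-∈ {S} eq))) l′∈S))
    by false eq = exchange≢A S∈ l′∈S eq (trans (sym (toUnprimed-∉ {S} eq)) eqA)

  primed≺unprimed : ∀ {p} → 𝒮ₚ p through primed l ≺ 𝒮ₚ p through unprimed l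
  primed≺unprimed = record
    { embedding = record
      { to        = toUnprimed
      ; maps      = λ (S∈ , l′∈S) → toUnprimed-𝒮ₚ S∈ l′∈S
      ; injective = λ (_ , l′∈S) (_ , l′∈T) → toUnprimed-injective l′∈S l′∈T
      }
    ; missed  = A m
    ; missed∈ = inj₁ (inj₁ (⊆orbit (inj₁ refl))) , proj₁ A-l
    ; misses  = λ (S∈ , l′∈S) → toUnprimed≢A S∈ l′∈S
    }

  -- So m attains the largest number of blocks through an element, and an isomorphism must respect
  -- this maximum.
  through≼unprimed : ∀ {p} e → 𝒮ₚ p through e ≼ 𝒮ₚ p through unprimed l
  through≼unprimed {p} e = at (half e)
    where
    at : ∀ {e} → Half {m} e → 𝒮ₚ p through e ≼ 𝒮ₚ p through unprimed l
    at (isUnprimed j) = through-unprimed j l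
    at (isPrimed j)   = ≼-trans (through-primed j l) (_≺_.embedding primed≺unprimed)

  -- The block [m] and the contradiction

  [m] : Subset (E m)
  [m] = F {m} ⊤

  [m]∈𝒮 : 𝒮ₚ 1ℙ [m]
  [m]∈𝒮 = inj₂ (⊤ , trans (cong parity (∣⊤∣≡n m)) m-odd , refl)

  -- Among the sets `F J` only J = [m] avoids the primed half, and its size m is odd. The other two
  -- kinds of block always contain a primed element.
  𝒮ₚ0-primed : ∀ {S} → 𝒮ₚ 0ℙ S → ¬ (∀ (j : Fin m) → lookup S (primed j) ≡ false)
  𝒮ₚ0-primed (inj₁ (inj₁ S∈)) = AB-primed S∈
  𝒮ₚ0-primed (inj₁ (inj₂ S∈)) = 𝒪-primed S∈
  𝒮ₚ0-primed (inj₂ (J , even , refl)) none = even≢odd (trans (sym even) (trans (cong (parity ∘ ∣_∣) J≡⊤)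
    (trans (cong parity (∣⊤∣≡n m)) m-odd)))
    where
    J≡⊤ : J ≡ ⊤
    J≡⊤ = lookup-ext λ j → trans (not-injective (trans (sym (F-primed J j)) (none j))) (sym (lookup-replicate j true))

  nonisomorphic : ¬ Isomorphic (𝒮ₚ 1ℙ) (𝒮ₚ 0ℙ)
  nonisomorphic (σ , fwd , bwd) = 𝒮ₚ0-primed (fwd ([m] , [m]∈𝒮 , refl)) λ j →
    trans (lookup-image σ [m] (primed j)) (at j (half (σ ⟨$⟩ˡ primed j)) refl)
    where
    σ≼ : ∀ e → 𝒮ₚ 1ℙ through e ≼ 𝒮ₚ 0ℙ through (σ ⟨$⟩ʳ e)
    σ≼ e = record
      { to        = image (σ ⟨$⟩ʳ_)
      ; maps      = λ {S} (S∈ , e∈S) → fwd (S , S∈ , refl) , trans (lookup-image-to σ S e) e∈S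
      ; injective = λ _ _ → image-injective σ
      }
    σ⁻ : Permutation (E m) (E m)
    σ⁻ = Perm.flip σ
    cancel : ∀ S → image (σ⁻ ⟨$⟩ʳ_) (image (σ ⟨$⟩ʳ_) S) ≡ S
    cancel S = lookup-ext λ e → trans (lookup-image σ⁻ (image (σ ⟨$⟩ʳ_) S) e) (lookup-image-to σ S e)
    σ⁻≼ : ∀ e → 𝒮ₚ 0ℙ through e ≼ 𝒮ₚ 1ℙ through (σ ⟨$⟩ˡ e)
    σ⁻≼ e = record
      { to        = image (σ⁻ ⟨$⟩ʳ_)
      ; maps      = λ {T} (T∈ , e∈T) → back (bwd T∈) , trans (lookup-image-to σ⁻ T e) e∈T
      ; injective = λ _ _ → image-injective σ⁻
      }
      where
      back : ∀ {T} → imageSystem (σ ⟨$⟩ʳ_) (𝒮ₚ 1ℙ) T → 𝒮ₚ 1ℙ (image (σ⁻ ⟨$⟩ʳ_) T)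
      back (S , S∈ , refl) = subst (𝒮ₚ 1ℙ) (sym (cancel S)) S∈
    at : ∀ (j : Fin m) {e} → Half {m} e → σ ⟨$⟩ˡ primed j ≡ e → lookup [m] e ≡ false
    at j (isPrimed i)   _  = trans (F-primed ⊤ i) (cong not (lookup-replicate i true))
    -- Suppose σ sends i to j′, and write d₁, d₂ for the numbers of blocks through an element in the
    -- two systems. Then d₂(m) ≤ d₁(σ⁻¹(m)) ≤ d₁(m) ≤ d₁(i) ≤ d₂(j′) ≤ d₂(m′) < d₂(m).
    at j (isUnprimed i) eq = contradiction
      (≼-≺-trans
        (≼-trans (σ⁻≼ (unprimed l)) (≼-trans (through≼unprimed (σ ⟨$⟩ˡ unprimed l))
          (≼-trans (through-unprimed l i) (≼-trans σi≼j (through-primed j l)))))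
        primed≺unprimed)
      ≺-irrefl
      where
      σi≼j : 𝒮ₚ 1ℙ through unprimed i ≼ 𝒮ₚ 0ℙ through primed j
      σi≼j = subst (λ e → 𝒮ₚ 1ℙ through unprimed i ≼ 𝒮ₚ 0ℙ through e)
        (trans (cong (σ ⟨$⟩ʳ_) (sym eq)) (inverseʳ σ)) (σ≼ (unprimed i))

proposition3p42 : ∀ (m : ℕ) → 3 ≤ m → Odd m → ¬ Isomorphic (𝒮₁ m) (𝒮₂ m)
proposition3p42 (suc (suc (suc k))) (s≤s (s≤s (s≤s z≤n))) m-odd = Critical.nonisomorphic k m-odd
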